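{- Let $G$ be a finite, undirected, simple, connected graph. Then $G\in\mathbf{m_3}/\mathbf{l_3}$ if and only if $G$ is $\{\text{hole}, D, F, X_5\}$-free. That is, $\mathbf{m_3}/\mathbf{l_3}=\{\text{hole}, D, F, X_5\}$-free.
   Context: All graphs are finite, undirected, simple and connected. A $uv$-walk is a sequence of (not necessarily distinct) vertices $W: u=v_0,v_1,\ldots,v_n=v$ with $v_{i-1}$ adjacent to $v_i$ for all $i\in\{1,\ldots,n\}$; $v_1,\ldots,v_{n-1}$ are its internal vertices and $n$ is its length. A $uv$-path is a $uv$-walk with distinct vertices. A $uv$-induced path is a $uv$-path in which two vertices are adjacent in $G$ if and only if they are consecutive on the path. For non-adjacent vertices $u,v$: - $\mathbf{m_3}(u,v)$ is the set of $uv$-$m_3$ paths, i.e. $uv$-induced paths of length at least three. - $\mathbf{l_3}(u,v)$ is the set of $uv$-$l_3$-paths, i.e. $uv$-induced paths of length at most $3$. Domination: for non-adjacent $u,v$, a $uv$-walk $W$ dominates a $uv$-walk $W'$ if every internal vertex of $W'$ is adjacent to some internal vertex of $W$ or belongs to $W$. The class $\mathbf{A}/\mathbf{B}$ consists of all graphs $G$ such that for every pair of non-adjacent vertices $u,v$ of $G$, every walk $W\in\mathbf{A}(u,v)$ dominates every walk $W'\in\mathbf{B}(u,v)$ (vacuously true if one of the sets is empty). A graph is $\mathcal{F}$-free if it contains no induced subgraph isomorphic to a member of $\mathcal{F}$. The graphs involved are: - a hole: a chordless cycle with at least five vertices (every such cycle is forbidden); - $D$ (domino): vertices $x_0,\ldots,x_5$,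 edges $x_0x_1,x_1x_2,x_2x_3,x_3x_4,x_4x_5,x_0x_5,x_1x_4$; - $X_5$: vertices $x_0,\ldots,x_5$, edges $x_0x_1,x_0x_5,x_1x_2,x_1x_5,x_2x_3,x_2x_5,x_3x_4,x_4x_5$; - $F$: vertices $x_0,\ldots,x_6$, edges $x_0x_1,x_0x_6,x_1x_2,x_2x_6,x_5x_6,x_2x_3,x_2x_5,x_3x_4,x_4x_5$. -}

module Defs where

open import Data.Fin using (Fin; zero; suc; toℕ; fromℕ; inject₁; _≟_; #_)
open import Data.Fin.Subset using (Subset; _∈_)
open import Data.List using (List; []; _∷_; map; allFin)
import Data.List.Membership.DecPropositional as DecMembership
open import Data.List.Membership.Propositional using () renaming (_∈_ to _∈ˡ_)
open import Data.Nat using (ℕ; zero; suc; _≤_; _<_)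
open import Data.Product using (Σ; ∃; ∃-syntax; _×_; _,_; proj₁)
open import Data.Product.Properties using (≡-dec)
open import Data.Sum using (_⊎_; swap)
open import Function using (_⇔_; _⤖_; Injective; Bijection)
open import Level using (0ℓ) renaming (suc to lsuc)
open import Relation.Binary using (Rel; Symmetric; Irreflexive; Decidable)
open import Relation.Binary.PropositionalEquality using (_≡_; _≢_; refl; ≢-sym)
open import Relation.Nullary using (¬_; ¬?; _×-dec_; _⊎-dec_)
open import Relation.Unary using (Pred)

-- Decidability of adjacency is part of what it means, constructively, to be
-- given a finite graph; finiteness itself is the choice V = Fin n.
record Graph (V : Set) : Set₁ where
  infix 4 _~_ _~?_
  field
    _~_      : Rel V 0ℓ
    ~-sym    : Symmetric _~_
    ~-irrefl : Irreflexive _≡_ _~_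
    _~?_     : Decidable _~_

record Walk {V : Set} (G : Graph V) (u v : V) : Set where
  open Graph G
  field
    length : ℕ
    vertex : Fin (suc length) → V
    start  : vertex zero ≡ u
    end    : vertex (fromℕ length) ≡ v
    step   : ∀ (i : Fin length) → vertex (inject₁ i) ~ vertex (suc i)

  Internal : Pred (Fin (suc length)) 0ℓ
  Internal i = 0 < toℕ i × toℕ i < length

Connected : ∀ {V} → Pred (Graph V) 0ℓ
Connected G = ∀ u v → Walk G u v

Consecutive : ∀ {k} → Rel (Fin k) 0ℓ
Consecutive i j = (toℕ j ≡ suc (toℕ i)) ⊎ (toℕ i ≡ suc (toℕ j))

module _ {V : Set} {G : Graph V} {u v : V} where
  open Graph G
  open Walk

  IsPath : Pred (Walk G u v) 0ℓ
  IsPath W = Injective _≡_ _≡_ (vertex W)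

  IsInducedPath : Pred (Walk G u v) 0ℓ
  IsInducedPath W =
    IsPath W × (∀ i j → (vertex W i ~ vertex W j) ⇔ Consecutive i j)

  Dominates : Rel (Walk G u v) 0ℓ
  Dominates W W′ = ∀ j → Internal W′ j →
      (∃[ i ] (Internal W i × vertex W′ j ~ vertex W i))
    ⊎ (∃[ i ] (vertex W′ j ≡ vertex W i))

WalkFamily : Set₁
WalkFamily = ∀ {V} (G : Graph V) (u v : V) → Pred (Walk G u v) 0ℓ

m₃ : WalkFamily
m₃ G u v W = IsInducedPath W × 3 ≤ Walk.length W

l₃ : WalkFamily
l₃ G u v W = IsInducedPath W × Walk.length W ≤ 3

infix 5 _/_
_/_ : WalkFamily → WalkFamily → ∀ {V} → Pred (Graph V) 0ℓ
(A / B) G = ∀ u v → ¬ (u ~ v) →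
  ∀ W W′ → A G u v W → B G u v W′ → Dominates W W′
  where open Graph G

-- Proofs of v ∈ S are unique, so ∃ (_∈ S) has exactly one element per v in S.
infix 6 _[_]
_[_] : ∀ {n} → Graph (Fin n) → (S : Subset n) → Graph (∃ (_∈ S))
G [ S ] = record
  { _~_      = λ x y → proj₁ x ~ proj₁ y
  ; ~-sym    = ~-sym
  ; ~-irrefl = λ { refl → ~-irrefl refl }
  ; _~?_     = λ x y → proj₁ x ~? proj₁ y
  }
  where open Graph G

infix 4 _≅_
_≅_ : ∀ {V W} → Graph V → Graph W → Set
_≅_ {V} {W} G H = Σ (V ⤖ W) λ f →
  ∀ x y → (x G.~ y) ⇔ (Bijection.to f x H.~ Bijection.to f y)
  where
  module G = Graph G
  module H = Graph H

GraphFamily : Set₂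
GraphFamily = ∀ {m} → Pred (Graph (Fin m)) (lsuc 0ℓ)

infix 5 _-free
_-free : GraphFamily → ∀ {n} → Pred (Graph (Fin n)) (lsuc 0ℓ)
(𝓕 -free) {n} G =
  ∀ {m} {H : Graph (Fin m)} → 𝓕 H → ¬ (∃[ S ] (G [ S ] ≅ H))

-- Each pair is listed in one orientation only.  The condition i ≢ j makes
-- adjacency irreflexive for any list; it only has an effect if the list
-- contains a pair (i , i).
fromEdges : ∀ {m} → List (Fin m × Fin m) → Graph (Fin m)
fromEdges {m} E = record
  { _~_      = λ i j → i ≢ j × ((i , j) ∈ˡ E ⊎ (j , i) ∈ˡ E)
  ; ~-sym    = λ { (i≢j , e) → ≢-sym i≢j , swap e }
  ; ~-irrefl = λ { i≡j (i≢j , _) → i≢j i≡j }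
  ; _~?_     = λ i j → ¬? (i ≟ j) ×-dec (((i , j) ∈? E) ⊎-dec ((j , i) ∈? E))
  }
  where open DecMembership (≡-dec (_≟_ {m}) (_≟_ {m})) using (_∈?_)

cycleEdges : ∀ m → List (Fin m × Fin m)
cycleEdges zero    = []
cycleEdges (suc k) = (fromℕ k , zero) ∷ map (λ i → inject₁ i , suc i) (allFin k)

-- A cycle graph in the usual sense only for 3 ≤ m.
cycle : ∀ m → Graph (Fin m)
cycle m = fromEdges (cycleEdges m)

D : Graph (Fin 6)
D = fromEdges
  ( (# 0 , # 1) ∷ (# 1 , # 2) ∷ (# 2 , # 3) ∷ (# 3 , # 4) ∷ (# 4 , # 5)
  ∷ (# 0 , # 5) ∷ (# 1 , # 4) ∷ [])

X₅ : Graph (Fin 6)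
X₅ = fromEdges
  ( (# 0 , # 1) ∷ (# 0 , # 5) ∷ (# 1 , # 2) ∷ (# 1 , # 5) ∷ (# 2 , # 3)
  ∷ (# 2 , # 5) ∷ (# 3 , # 4) ∷ (# 4 , # 5) ∷ [])

F : Graph (Fin 7)
F = fromEdges
  ( (# 0 , # 1) ∷ (# 0 , # 6) ∷ (# 1 , # 2) ∷ (# 2 , # 6) ∷ (# 5 , # 6)
  ∷ (# 2 , # 3) ∷ (# 2 , # 5) ∷ (# 3 , # 4) ∷ (# 4 , # 5) ∷ [])

-- The family {hole, D, F, X₅}.
data HoleDFX₅ : ∀ {m} → Graph (Fin m) → Set₁ where
  hole   : ∀ {m} → 5 ≤ m → HoleDFX₅ (cycle m)
  domino : HoleDFX₅ D
  fgraph : HoleDFX₅ F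
  xgraph : HoleDFX₅ X₅

{-# OPTIONS --safe #-}
module Submission where

-- Each of hole, D, F, X₅ contains two induced paths showing that it is not in
-- m₃ / l₃, and m₃ / l₃ is hereditary.  Conversely, let x be an internal vertex
-- of an l₃-path W′ which an m₃-path W does not dominate.  If W′ has length two,
-- x and W form a hole.  If it has length three, let y be its other internal
-- vertex: x followed by W, starting at the end next to x, is an induced path
-- p₀, …, p_N with N ≥ 4 whose ends are neighbours of y, and y is not adjacent
-- to p₁.  Without holes, successive neighbours of y on that path are at most
-- two apart.  So y ~ p₂, and the gaps after p₂ decide the case:
-- p₀, p₂, p₄ gives D; p₀, p₂, p₃, p₄ gives X₅; p₀, p₂, p₃, p₅ gives F.

open import Defs
open import Data.Fin using (Fin; zero; suc; toℕ; fromℕ; fromℕ<; inject₁; #_)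
import Data.Fin as Fin
open import Data.Fin.Properties
  using (toℕ-injective; toℕ-fromℕ; toℕ-fromℕ<; toℕ-inject₁; toℕ<n; any?; all?)
open import Data.Fin.Subset using (Subset; _∈_)
open import Data.List using (List; []; _∷_; upTo)
open import Data.List.Membership.DecPropositional using () renaming (_∈?_ to mk∈?)
open import Data.List.Membership.Propositional using () renaming (_∈_ to _∈ˡ_)
open import Data.List.Membership.Propositional.Properties using (∈-map⁺; ∈-map⁻; ∈-allFin; ∈-upTo⁺)
open import Data.List.Relation.Unary.All as All using (All; []; _∷_)
open import Data.List.Relation.Unary.Any using (here; there)
open import Data.Nat
  using (ℕ; zero; suc; _+_; _∸_; _≤_; _<_; z≤n; s≤s; _≟_; _<?_; _≤?_)
open import Data.Nat.Induction using (<-rec)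
open import Data.Nat.Properties
  using ( ≤-refl; ≤-trans; ≤-pred; <⇒≤; <-≤-trans; ≤∧≢⇒<; 1+n≢n; 1+n≰n; suc-injective
        ; m⊓n≤n; m≤n⇒m⊓n≡m; ∸-cancelˡ-≡; m∸[m∸n]≡n; m∸n≤m; +-∸-assoc; anyUpTo?; m<n⇒0<n∸m; n∸n≡0
        ; ∸-monoʳ-< )
open import Data.Product using (∃; ∃-syntax; _×_; _,_; proj₁; proj₂)
open import Data.Sum using (_⊎_; inj₁; inj₂; swap)
open import Data.Vec using (_∷_; []; lookup; tabulate)
open import Data.Vec.Properties using ([]=⇒lookup; lookup⇒[]=; lookup∘tabulate)
open import Data.Vec.Properties.WithK using ([]=-irrelevant)
open import Data.Empty using (⊥; ⊥-elim)
open import Function.Properties.Equivalence using () renaming (sym to ⇔-sym; trans to ⇔-trans)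
open import Function using (_⇔_; _∘_; id; Injective; Bijection; Equivalence; mk⇔; mk⤖)
open import Relation.Binary using (DecidableEquality)
open import Relation.Binary.PropositionalEquality
  using (_≡_; _≢_; refl; sym; trans; cong; subst; subst₂)
open import Relation.Nullary
  using (¬_; Dec; yes; no; does; contradiction; _×-dec_; _⊎-dec_; _→-dec_)
open import Relation.Nullary.Decidable
  using (from-yes; from-no; dec-true; map′; decidable-stable)

open Equivalence using (to; from)
open Graph using (~-sym; ~-irrefl; _~?_)

-- Embeddings and induced subgraphs

infix 4 _⊢_~_
_⊢_~_ : ∀ {V} → Graph V → V → V → Set
G ⊢ x ~ y = Graph._~_ G x y

-- An isomorphism onto an induced subgraph, presented by its map alone, so that copies of forbidden
-- graphs can be composed.
record IsEmbedding {V W : Set} (H : Graph W) (G : Graph V) (f : W → V) : Set where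
  constructor _,_
  field
    injective : Injective _≡_ _≡_ f
    adjacent  : ∀ x y → H ⊢ x ~ y ⇔ G ⊢ f x ~ f y

open IsEmbedding

isEmbedding? : ∀ {m V} (H : Graph (Fin m)) (G : Graph V) → DecidableEquality V →
               ∀ f → Dec (IsEmbedding H G f)
isEmbedding? H G _≟ⱽ_ f =
  map′ (λ h → (λ {x} {y} → proj₁ (h x y)) , λ x y → mk⇔ (proj₁ (proj₂ (h x y))) (proj₂ (proj₂ (h x y))))
       (λ e x y → injective e , to (adjacent e x y) , from (adjacent e x y))
       (all? λ x → all? λ y →
          ((f x ≟ⱽ f y) →-dec (x Fin.≟ y))
          ×-dec ((_~?_ H x y →-dec _~?_ G (f x) (f y)) ×-dec (_~?_ G (f x) (f y) →-dec _~?_ H x y)))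

∈-unique : ∀ {n} {S : Subset n} {a b : ∃ (_∈ S)} → proj₁ a ≡ proj₁ b → a ≡ b
∈-unique {a = x , p} {b = .x , q} refl = cong (x ,_) ([]=-irrelevant p q)

-- The subset is the image of `f`. The bijection demanded by `≅` runs from the subset to `H`, so it
-- is the inverse of `f`, found by search.
embedding⇒induced : ∀ {n m} {G : Graph (Fin n)} {H : Graph (Fin m)} {f} →
                    IsEmbedding H G f → ∃[ S ] (G [ S ] ≅ H)
embedding⇒induced {n} {m} {G} {H} {f} (inj , adj) = S , mk⤖ (label-inj , label-surj) , label-adj
  where
  hit? : ∀ v → Dec (∃[ i ] (f i ≡ v))
  hit? v = any? (λ i → f i Fin.≟ v)

  S : Subset n
  S = tabulate (does ∘ hit?)

  hit : ∀ v → v ∈ S → ∃[ i ] (f i ≡ v)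
  -- Membership in the tabulated subset says that `hit? v` decides positively, which rules out the
  -- `no` branch.
  hit v v∈S with hit? v | trans (sym (lookup∘tabulate (does ∘ hit?) v)) ([]=⇒lookup v∈S)
  ... | yes h | _ = h

  label : ∃ (_∈ S) → Fin m
  label (v , v∈S) = proj₁ (hit v v∈S)

  f-label : ∀ a → f (label a) ≡ proj₁ a
  f-label (v , v∈S) = proj₂ (hit v v∈S)

  f∈S : ∀ i → f i ∈ S
  f∈S i = lookup⇒[]= (f i) S
    (trans (lookup∘tabulate (does ∘ hit?) (f i)) (dec-true (hit? (f i)) (i , refl)))

  label-inj : Injective _≡_ _≡_ label
  label-inj {a} {b} eq = ∈-unique (trans (sym (f-label a)) (trans (cong f eq) (f-label b)))

  label-surj : ∀ i → ∃[ a ] (∀ {b} → b ≡ a → label b ≡ i)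
  label-surj i = (f i , f∈S i) , λ { refl → inj (f-label (f i , f∈S i)) }

  label-adj : ∀ a b → G [ S ] ⊢ a ~ b ⇔ H ⊢ label a ~ label b
  label-adj a b = ⇔-sym (subst₂ (λ x y → H ⊢ label a ~ label b ⇔ G ⊢ x ~ y)
                                (f-label a) (f-label b) (adj (label a) (label b)))

induced⇒embedding : ∀ {n m} {G : Graph (Fin n)} {H : Graph (Fin m)} {S} →
                    G [ S ] ≅ H → ∃[ f ] IsEmbedding H G f
induced⇒embedding {n} {m} {G} {H} {S} (b , adj) = proj₁ ∘ pre , pre-inj , pre-adj
  where
  pre : Fin m → ∃ (_∈ S)
  pre i = proj₁ (Bijection.surjective b i)

  label-pre : ∀ i → Bijection.to b (pre i) ≡ i
  label-pre i = proj₂ (Bijection.surjective b i) refl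

  pre-inj : Injective _≡_ _≡_ (proj₁ ∘ pre)
  pre-inj {x} {y} eq =
    trans (sym (label-pre x)) (trans (cong (Bijection.to b) (∈-unique eq)) (label-pre y))

  pre-adj : ∀ x y → H ⊢ x ~ y ⇔ G ⊢ proj₁ (pre x) ~ proj₁ (pre y)
  pre-adj x y = ⇔-sym (subst₂ (λ i j → G ⊢ proj₁ (pre x) ~ proj₁ (pre y) ⇔ H ⊢ i ~ j)
                              (label-pre x) (label-pre y) (adj (pre x) (pre y)))

-- Heredity of the domination property

mapWalk : ∀ {V W} {H : Graph W} {G : Graph V} {f} → IsEmbedding H G f →
          ∀ {u v} → Walk H u v → Walk G (f u) (f v)
mapWalk {f = f} (_ , adj) W = record
  { length = length
  ; vertex = f ∘ vertex
  ; start  = cong f start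
  ; end    = cong f end
  ; step   = λ i → to (adj _ _) (step i)
  } where open Walk W

mapWalk-induced : ∀ {V W} {H : Graph W} {G : Graph V} {f} (e : IsEmbedding H G f) →
                  ∀ {u v} {W : Walk H u v} → IsInducedPath W → IsInducedPath (mapWalk e W)
mapWalk-induced (inj , adj) (path , ind) =
  (path ∘ inj) , λ i j → ⇔-trans (⇔-sym (adj _ _)) (ind i j)

-- Both walks are carried to `G` with their lengths and inducedness. The dominating vertex found
-- there lies on the image of `W`, so the adjacency or equality reflects back to `H`.
m₃/l₃-hereditary : ∀ {V W} {H : Graph W} {G : Graph V} {f} → IsEmbedding H G f →
                   (m₃ / l₃) G → (m₃ / l₃) H
m₃/l₃-hereditary {f = f} e@(inj , adj) dom u v u≁v W W′ (W-ind , 3≤) (W′-ind , ≤3) j int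
  with dom (f u) (f v) (u≁v ∘ from (adj u v)) (mapWalk e W) (mapWalk e W′)
           (mapWalk-induced e {W = W} W-ind , 3≤) (mapWalk-induced e {W = W′} W′-ind , ≤3) j int
... | inj₁ (i , i-int , a) = inj₁ (i , i-int , from (adj _ _) a)
... | inj₂ (i , eq)        = inj₂ (i , inj eq)

-- Paths and fans indexed by natural numbers

path : Graph ℕ
path = record
  { _~_      = λ i j → (j ≡ suc i) ⊎ (i ≡ suc j)
  ; ~-sym    = swap
  ; ~-irrefl = λ { refl (inj₁ eq) → 1+n≢n (sym eq) ; refl (inj₂ eq) → 1+n≢n (sym eq) }
  ; _~?_     = λ i j → (j ≟ suc i) ⊎-dec (i ≟ suc j)
  }

infix 4 _∈ᴺ?_
_∈ᴺ?_ : ∀ (i : ℕ) S → Dec (i ∈ˡ S)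
_∈ᴺ?_ = mk∈? _≟_

-- The apex is 0, and suc i is the vertex i of the path; S lists the
-- neighbours of the apex on the path.
fan : List ℕ → Graph ℕ
fan S = record
  { _~_      = adj
  ; ~-sym    = λ {i} {j} → adj-sym i j
  ; ~-irrefl = λ {i} {j} → adj-irrefl i j
  ; _~?_     = adj?
  }
  where
  adj : ℕ → ℕ → Set
  adj zero    zero    = ⊥
  adj zero    (suc j) = j ∈ˡ S
  adj (suc i) zero    = i ∈ˡ S
  adj (suc i) (suc j) = path ⊢ i ~ j

  adj-sym : ∀ i j → adj i j → adj j i
  adj-sym zero    (suc j) a = a
  adj-sym (suc i) zero    a = a
  adj-sym (suc i) (suc j) a = swap a

  adj-irrefl : ∀ i j → i ≡ j → ¬ adj i j
  adj-irrefl (suc i) (suc .i) refl a = ~-irrefl path refl a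

  adj? : ∀ i j → Dec (adj i j)
  adj? zero    zero    = no id
  adj? zero    (suc j) = j ∈ᴺ? S
  adj? (suc i) zero    = i ∈ᴺ? S
  adj? (suc i) (suc j) = _~?_ path i j

infixr 5 _◂_
_◂_ : ∀ {V : Set} → V → (ℕ → V) → ℕ → V
(x ◂ p) zero    = x
(x ◂ p) (suc i) = p i

-- p embeds the subgraph of H induced by 0, …, N; beyond N its values are junk.
record EmbedsUpTo {V : Set} (H : Graph ℕ) (G : Graph V) (N : ℕ) (p : ℕ → V) : Set where
  constructor embedsUpTo
  field
    at : ∀ {i j} → i ≤ N → j ≤ N → (p i ≡ p j → i ≡ j) × (H ⊢ i ~ j ⇔ G ⊢ p i ~ p j)

open EmbedsUpTo

embedding-∘ : ∀ {V m} {K : Graph (Fin m)} {H : Graph ℕ} {G : Graph V} {N p σ} →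
              IsEmbedding K H σ → (∀ i → σ i ≤ N) → EmbedsUpTo H G N p → IsEmbedding K G (p ∘ σ)
embedding-∘ (inj , adj) σ≤N e =
    (λ {x} {y} → inj ∘ proj₁ (at e (σ≤N x) (σ≤N y)))
  , (λ x y → ⇔-trans (adj x y) (proj₂ (at e (σ≤N x) (σ≤N y))))

path-prefix : ∀ {V} {G : Graph V} {N M p} → M ≤ N → EmbedsUpTo path G N p → EmbedsUpTo path G M p
path-prefix M≤N e = embedsUpTo λ i≤M j≤M → at e (≤-trans i≤M M≤N) (≤-trans j≤M M≤N)

path-suc : ∀ i j → path ⊢ i ~ j ⇔ path ⊢ suc i ~ suc j
path-suc i j = mk⇔
  (λ { (inj₁ eq) → inj₁ (cong suc eq) ; (inj₂ eq) → inj₂ (cong suc eq) })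
  (λ { (inj₁ eq) → inj₁ (suc-injective eq) ; (inj₂ eq) → inj₂ (suc-injective eq) })

path-tail : ∀ {V} {G : Graph V} {N p} →
            EmbedsUpTo path G (suc N) p → EmbedsUpTo path G N (p ∘ suc)
path-tail e = embedsUpTo λ {i} {j} i≤N j≤N →
  let inj , adj = at e (s≤s i≤N) (s≤s j≤N) in
  (suc-injective ∘ inj) , ⇔-trans (path-suc i j) adj

path-flip : ∀ {N i j} → i ≤ N → j ≤ N → path ⊢ i ~ j → path ⊢ (N ∸ i) ~ (N ∸ j)
path-flip i≤N j≤N (inj₁ refl) = inj₂ (+-∸-assoc 1 j≤N)
path-flip i≤N j≤N (inj₂ refl) = inj₁ (+-∸-assoc 1 i≤N)

path-reverse : ∀ {V} {G : Graph V} {N p} →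
               EmbedsUpTo path G N p → EmbedsUpTo path G N (p ∘ (N ∸_))
path-reverse {N = N} e = embedsUpTo λ {i} {j} i≤N j≤N →
  let inj , adj = at e (m∸n≤m N i) (m∸n≤m N j) in
    (∸-cancelˡ-≡ i≤N j≤N ∘ inj)
  , ⇔-trans (mk⇔ (path-flip i≤N j≤N)
                 -- The reflection is an involution on 0, ..., `N`, so the converse is `path-flip`
                 -- at the reflected indices.
                 (subst₂ (path ⊢_~_) (m∸[m∸n]≡n i≤N) (m∸[m∸n]≡n j≤N)
                   ∘ path-flip (m∸n≤m N i) (m∸n≤m N j)))
            adj

fan-embeds : ∀ {V} {G : Graph V} {N p y S} → EmbedsUpTo path G N p →
             (∀ {i} → i ≤ N → y ≢ p i) → (∀ {i} → i ≤ N → i ∈ˡ S ⇔ G ⊢ y ~ p i) →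
             EmbedsUpTo (fan S) G (suc N) (y ◂ p)
fan-embeds {G = G} {N} {p} {y} {S} e y∉p y-nbrs = embedsUpTo λ {i} {j} → embeds i j
  where
  embeds : ∀ i j → i ≤ suc N → j ≤ suc N →
           ((y ◂ p) i ≡ (y ◂ p) j → i ≡ j) × (fan S ⊢ i ~ j ⇔ G ⊢ (y ◂ p) i ~ (y ◂ p) j)
  embeds zero    zero    _         _         = (λ _ → refl) , mk⇔ ⊥-elim (~-irrefl G refl)
  embeds zero    (suc j) _         (s≤s j≤N) = (λ eq → contradiction eq (y∉p j≤N)) , y-nbrs j≤N
  embeds (suc i) zero    (s≤s i≤N) _         =
    (λ eq → contradiction (sym eq) (y∉p i≤N)) , ⇔-trans (y-nbrs i≤N) (mk⇔ (~-sym G) (~-sym G))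
  embeds (suc i) (suc j) (s≤s i≤N) (s≤s j≤N) =
    let inj , adj = at e i≤N j≤N in (cong suc ∘ inj) , adj

-- An apex that sees only the first vertex of a path just lengthens it by one; extending a path thus
-- becomes a case of `fan-embeds`.
fan-is-path : ∀ i j → path ⊢ i ~ j ⇔ fan (0 ∷ []) ⊢ i ~ j
fan-is-path zero zero = mk⇔ (λ { (inj₁ ()) ; (inj₂ ()) }) ⊥-elim
fan-is-path zero (suc j) = mk⇔ (λ { (inj₁ refl) → here refl ; (inj₂ ()) }) (λ { (here refl) → inj₁ refl })
fan-is-path (suc i) zero = mk⇔ (λ { (inj₂ refl) → here refl ; (inj₁ ()) }) (λ { (here refl) → inj₂ refl })
fan-is-path (suc i) (suc j) = ⇔-sym (path-suc i j)

path-extend : ∀ {V} {G : Graph V} {N p x} → EmbedsUpTo path G N p →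
              (∀ {i} → i ≤ N → x ≢ p i) → G ⊢ x ~ p 0 →
              (∀ {i} → 0 < i → i ≤ N → ¬ G ⊢ x ~ p i) →
              EmbedsUpTo path G (suc N) (x ◂ p)
path-extend {G = G} {N} {p} {x} e x∉p x~p₀ x≁p = embedsUpTo λ {i} {j} i≤ j≤ →
  let inj , adj = at (fan-embeds e x∉p nbrs) i≤ j≤ in inj , ⇔-trans (fan-is-path i j) adj
  where
  nbrs : ∀ {i} → i ≤ N → i ∈ˡ (0 ∷ []) ⇔ G ⊢ x ~ p i
  nbrs {zero}  _   = mk⇔ (λ _ → x~p₀) (λ _ → here refl)
  nbrs {suc i} i≤N = mk⇔ (λ { (here ()) ; (there ()) }) (λ a → contradiction a (x≁p (s≤s z≤n) i≤N))

-- Cycles as fans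

∈-cycleEdges : ∀ {k} {i j : Fin (suc k)} →
               (i , j) ∈ˡ cycleEdges (suc k) ⇔ ((i ≡ fromℕ k × j ≡ zero) ⊎ toℕ j ≡ suc (toℕ i))
∈-cycleEdges {k} = mk⇔ (λ { (here refl) → inj₁ (refl , refl) ; (there e) → succ e }) mem
  where
  succ : ∀ {i j} → (i , j) ∈ˡ _ → (i ≡ fromℕ k × j ≡ zero) ⊎ toℕ j ≡ suc (toℕ i)
  succ e with ∈-map⁻ (λ l → inject₁ l , suc l) e
  ... | l , _ , refl = inj₂ (cong suc (sym (toℕ-inject₁ l)))

  mem : ∀ {i j} → (i ≡ fromℕ k × j ≡ zero) ⊎ toℕ j ≡ suc (toℕ i) → (i , j) ∈ˡ cycleEdges (suc k)
  mem (inj₁ (refl , refl)) = here refl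
  mem {i} {suc l} (inj₂ eq)
    with refl ← toℕ-injective {i = i} {j = inject₁ l} (trans (sym (suc-injective eq)) (sym (toℕ-inject₁ l)))
    = there (∈-map⁺ (λ l → inject₁ l , suc l) (∈-allFin l))

-- Vertex 0 of the cycle is the apex and the rest is a path whose two ends are its neighbours. Holes
-- can then be handled like the other forbidden graphs.
cycle-is-fan : ∀ K → IsEmbedding (cycle (2 + K)) (fan (0 ∷ K ∷ [])) toℕ
cycle-is-fan K = toℕ-injective , λ i j → mk⇔ (adj⁺ i j) (adj⁻ i j)
  where
  S : List ℕ
  S = 0 ∷ K ∷ []

  fan-step : ∀ i → fan S ⊢ i ~ suc i
  fan-step zero    = here refl
  fan-step (suc i) = inj₁ refl

  edge⁺ : ∀ {i j} → (i , j) ∈ˡ cycleEdges (2 + K) → fan S ⊢ toℕ i ~ toℕ j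
  edge⁺ {i} {j} e with to ∈-cycleEdges e
  ... | inj₁ (refl , refl) = there (here (toℕ-fromℕ K))
  ... | inj₂ eq = subst (fan S ⊢ toℕ i ~_) (sym eq) (fan-step (toℕ i))

  adj⁺ : ∀ i j → cycle (2 + K) ⊢ i ~ j → fan S ⊢ toℕ i ~ toℕ j
  adj⁺ i j (_ , inj₁ e) = edge⁺ e
  adj⁺ i j (_ , inj₂ e) = ~-sym (fan S) {toℕ j} {toℕ i} (edge⁺ e)

  Edge : Fin (2 + K) → Fin (2 + K) → Set
  Edge i j = (i , j) ∈ˡ cycleEdges (2 + K)

  edge⁻ : ∀ i j → fan S ⊢ toℕ i ~ toℕ j → Edge i j ⊎ Edge j i
  edge⁻ zero (suc j) (here eq) = inj₁ (from ∈-cycleEdges (inj₂ (cong suc eq)))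
  edge⁻ zero (suc j) (there (here eq)) = inj₂ (from ∈-cycleEdges
    (inj₁ (cong suc (toℕ-injective (trans eq (sym (toℕ-fromℕ K)))) , refl)))
  edge⁻ (suc i) zero (here eq) = inj₂ (from ∈-cycleEdges (inj₂ (cong suc eq)))
  edge⁻ (suc i) zero (there (here eq)) = inj₁ (from ∈-cycleEdges
    (inj₁ (cong suc (toℕ-injective (trans eq (sym (toℕ-fromℕ K)))) , refl)))
  edge⁻ (suc i) (suc j) (inj₁ eq) = inj₁ (from ∈-cycleEdges (inj₂ (cong suc eq)))
  edge⁻ (suc i) (suc j) (inj₂ eq) = inj₂ (from ∈-cycleEdges (inj₂ (cong suc eq)))

  adj⁻ : ∀ i j → fan S ⊢ toℕ i ~ toℕ j → cycle (2 + K) ⊢ i ~ j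
  adj⁻ i j a = (λ { refl → ~-irrefl (fan S) {toℕ i} refl a }) , edge⁻ i j a

-- The forbidden graphs violate domination

InducedSequence : ∀ {V k} → Graph V → (Fin (suc k) → V) → Set
InducedSequence G vs = Injective _≡_ _≡_ vs × (∀ i j → (G ⊢ vs i ~ vs j) ⇔ Consecutive i j)

inducedSequence? : ∀ {m k} (H : Graph (Fin m)) (vs : Fin (suc k) → Fin m) →
                   Dec (InducedSequence H vs)
inducedSequence? {k = k} H vs =
  map′ (λ (inj , adj) → (λ {x} {y} → inj {x} {y}) , λ i j → ⇔-sym (adj i j))
       (λ (inj , adj) → (λ {x} {y} → inj {x} {y}) , λ i j → ⇔-sym (adj i j))
       (isEmbedding? P H Fin._≟_ vs)
  where
  P : Graph (Fin (suc k))
  P = record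
    { _~_      = Consecutive
    ; ~-sym    = swap
    ; ~-irrefl = λ { refl → ~-irrefl path refl }
    ; _~?_     = λ i j → _~?_ path (toℕ i) (toℕ j)
    }

walkOf : ∀ {V k u v} (H : Graph V) (vs : Fin (suc k) → V) → InducedSequence H vs →
         vs zero ≡ u → vs (fromℕ k) ≡ v → Walk H u v
walkOf H vs (_ , adj) start end = record
  { vertex = vs ; start = start ; end = end
  ; step = λ i → from (adj (inject₁ i) (suc i)) (inj₁ (cong suc (sym (toℕ-inject₁ i)))) }

IsDominated : ∀ {V k} → Graph V → (Fin (suc k) → V) → V → Set
IsDominated {k = k} G vs x =
    (∃[ i ] ((0 < toℕ i × toℕ i < k) × G ⊢ x ~ vs i))
  ⊎ (∃[ i ] (x ≡ vs i))

isDominated? : ∀ {V k} (G : Graph V) → DecidableEquality V → (vs : Fin (suc k) → V) →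
               ∀ x → Dec (IsDominated G vs x)
isDominated? {k = k} G _≟ⱽ_ vs x =
  any? (λ i → ((0 <? toℕ i) ×-dec (toℕ i <? k)) ×-dec _~?_ G x (vs i))
  ⊎-dec any? (λ i → x ≟ⱽ vs i)

-- Here `vs` is the dominating candidate and `ws` the short path. Stating this for bare sequences
-- lets the inducedness and domination conditions on `D`, `X₅` and `F` be settled by evaluation.
undominated⇒∉m₃/l₃ :
  ∀ {V k l} (G : Graph V) (vs : Fin (suc k) → V) (ws : Fin (suc l) → V) →
  vs zero ≡ ws zero → vs (fromℕ k) ≡ ws (fromℕ l) → ¬ G ⊢ ws zero ~ ws (fromℕ l) →
  InducedSequence G vs → 3 ≤ k → InducedSequence G ws → l ≤ 3 →
  ∀ j → 0 < toℕ j → toℕ j < l → ¬ IsDominated G vs (ws j) → ¬ (m₃ / l₃) G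
undominated⇒∉m₃/l₃ G vs ws start end u≁v vs-ind 3≤k ws-ind l≤3 j 0<j j<l undom dom =
  undom (dom _ _ u≁v (walkOf G vs vs-ind start end) (walkOf G ws ws-ind refl refl)
             (vs-ind , 3≤k) (ws-ind , l≤3) j (0<j , j<l))

-- The only neighbours of x₂ are x₁ and x₃; the path `vs` avoids x₁ and meets x₃ only as its end,
-- which is not internal.
D-∉m₃/l₃ : ¬ (m₃ / l₃) D
D-∉m₃/l₃ = undominated⇒∉m₃/l₃ D vs ws refl refl (from-no (_~?_ D (# 0) (# 3)))
  (from-yes (inducedSequence? D vs)) ≤-refl (from-yes (inducedSequence? D ws)) ≤-refl
  (# 2) (s≤s z≤n) ≤-refl (from-no (isDominated? D Fin._≟_ vs (# 2)))
  where
  vs ws : Fin 4 → Fin 6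
  vs = lookup (# 0 ∷ # 5 ∷ # 4 ∷ # 3 ∷ [])
  ws = lookup (# 0 ∷ # 1 ∷ # 2 ∷ # 3 ∷ [])

-- The missed vertex is x₄, with neighbours x₃, an end of `vs`, and x₅, which is off `vs`.
X₅-∉m₃/l₃ : ¬ (m₃ / l₃) X₅
X₅-∉m₃/l₃ = undominated⇒∉m₃/l₃ X₅ vs ws refl refl (from-no (_~?_ X₅ (# 0) (# 3)))
  (from-yes (inducedSequence? X₅ vs)) ≤-refl (from-yes (inducedSequence? X₅ ws)) ≤-refl
  (# 2) (s≤s z≤n) ≤-refl (from-no (isDominated? X₅ Fin._≟_ vs (# 4)))
  where
  vs ws : Fin 4 → Fin 6
  vs = lookup (# 0 ∷ # 1 ∷ # 2 ∷ # 3 ∷ [])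
  ws = lookup (# 0 ∷ # 5 ∷ # 4 ∷ # 3 ∷ [])

-- The missed vertex is x₃, with neighbours x₄, an end of `vs`, and x₂, which is off `vs`.
F-∉m₃/l₃ : ¬ (m₃ / l₃) F
F-∉m₃/l₃ = undominated⇒∉m₃/l₃ F vs ws refl refl (from-no (_~?_ F (# 1) (# 4)))
  (from-yes (inducedSequence? F vs)) (from-yes (3 ≤? 4)) (from-yes (inducedSequence? F ws)) ≤-refl
  (# 2) (s≤s z≤n) ≤-refl (from-no (isDominated? F Fin._≟_ vs (# 3)))
  where
  vs : Fin 5 → Fin 7
  vs = lookup (# 1 ∷ # 0 ∷ # 6 ∷ # 5 ∷ # 4 ∷ [])
  ws : Fin 4 → Fin 7
  ws = lookup (# 1 ∷ # 2 ∷ # 3 ∷ # 4 ∷ [])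

two-step-induced : ∀ {V} {G : Graph V} {a b c} → G ⊢ a ~ b → G ⊢ b ~ c → ¬ G ⊢ a ~ c → a ≢ c →
                   InducedSequence G (lookup (a ∷ b ∷ c ∷ []))
two-step-induced {V} {G} {a} {b} {c} a~b b~c a≁c a≢c = (λ {i} {j} → inj i j) , adj
  where
  vs : Fin 3 → V
  vs = lookup (a ∷ b ∷ c ∷ [])

  loop : ∀ i → (G ⊢ vs i ~ vs i) ⇔ Consecutive i i
  loop i = mk⇔ (λ l → contradiction l (~-irrefl G refl)) (λ l → contradiction l (~-irrefl path refl))

  inj : ∀ i j → vs i ≡ vs j → i ≡ j
  inj zero zero _ = refl
  inj zero (suc zero) eq = contradiction a~b (~-irrefl G eq)
  inj zero (suc (suc zero)) eq = contradiction eq a≢c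
  inj (suc zero) zero eq = contradiction a~b (~-irrefl G (sym eq))
  inj (suc zero) (suc zero) _ = refl
  inj (suc zero) (suc (suc zero)) eq = contradiction b~c (~-irrefl G eq)
  inj (suc (suc zero)) zero eq = contradiction (sym eq) a≢c
  inj (suc (suc zero)) (suc zero) eq = contradiction b~c (~-irrefl G (sym eq))
  inj (suc (suc zero)) (suc (suc zero)) _ = refl

  adj : ∀ i j → (G ⊢ vs i ~ vs j) ⇔ Consecutive i j
  adj zero zero = loop zero
  adj zero (suc zero) = mk⇔ (λ _ → inj₁ refl) (λ _ → a~b)
  adj zero (suc (suc zero)) = mk⇔ (λ a~c → contradiction a~c a≁c) (λ { (inj₁ ()) ; (inj₂ ()) })
  adj (suc zero) zero = mk⇔ (λ _ → inj₂ refl) (λ _ → ~-sym G a~b)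
  adj (suc zero) (suc zero) = loop (suc zero)
  adj (suc zero) (suc (suc zero)) = mk⇔ (λ _ → inj₁ refl) (λ _ → b~c)
  adj (suc (suc zero)) zero =
    mk⇔ (λ c~a → contradiction (~-sym G c~a) a≁c) (λ { (inj₁ ()) ; (inj₂ ()) })
  adj (suc (suc zero)) (suc zero) = mk⇔ (λ _ → inj₂ refl) (λ _ → ~-sym G b~c)
  adj (suc (suc zero)) (suc (suc zero)) = loop (suc (suc zero))

-- The two neighbours of vertex 0 are joined by the path of length two through 0 and by the rest of
-- the cycle, enumerated by `suc`. The latter has length `K`, at least three, and its internal
-- vertices are not adjacent to 0.
cycle-∉m₃/l₃ : ∀ {m} → 5 ≤ m → ¬ (m₃ / l₃) (cycle m)
cycle-∉m₃/l₃ (s≤s (s≤s {n = K} 3≤K)) = undominated⇒∉m₃/l₃ C suc ws refl refl a≁c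
  ((λ { refl → refl }) , long-adj) 3≤K ws-ind (from-yes (2 ≤? 3)) (# 1) (s≤s z≤n) ≤-refl undominated
  where
  C : Graph (Fin (2 + K))
  C = cycle (2 + K)

  last : Fin (2 + K)
  last = fromℕ (suc K)

  adj : ∀ i j → C ⊢ i ~ j ⇔ fan (0 ∷ K ∷ []) ⊢ toℕ i ~ toℕ j
  adj = adjacent (cycle-is-fan K)

  long-adj : ∀ (i j : Fin (suc K)) → (C ⊢ suc i ~ suc j) ⇔ Consecutive i j
  long-adj i j = adj (suc i) (suc j)

  K≢ : ∀ {k} → k < 3 → K ≢ k
  K≢ k<3 refl = 1+n≰n (<-≤-trans k<3 3≤K)

  a≁c : ¬ C ⊢ suc zero ~ last
  a≁c a with to (adj (suc zero) last) a
  ... | inj₁ eq = K≢ (s≤s (s≤s z≤n)) (trans (sym (toℕ-fromℕ K)) eq)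
  ... | inj₂ ()

  a≢c : suc zero ≢ last
  a≢c eq = K≢ (s≤s z≤n) (trans (sym (toℕ-fromℕ K)) (suc-injective (cong toℕ (sym eq))))

  ws : Fin 3 → Fin (2 + K)
  ws = lookup (suc zero ∷ zero ∷ last ∷ [])

  ws-ind : InducedSequence C ws
  ws-ind = two-step-induced {G = C} (from (adj (suc zero) zero) (here refl))
             (from (adj zero last) (there (here (toℕ-fromℕ K)))) a≁c a≢c

  undominated : ¬ IsDominated C (suc {n = suc K}) zero
  undominated (inj₁ (i , (0<i , i<K) , a)) with to (adj zero (suc i)) a
  ... | here eq         = 1+n≰n (subst (0 <_) eq 0<i)
  ... | there (here eq) = 1+n≰n (subst (_< K) eq i<K)

HoleDFX₅-∉m₃/l₃ : ∀ {m} {H : Graph (Fin m)} → HoleDFX₅ H → ¬ (m₃ / l₃) H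
HoleDFX₅-∉m₃/l₃ (hole 5≤m) = cycle-∉m₃/l₃ 5≤m
HoleDFX₅-∉m₃/l₃ domino     = D-∉m₃/l₃
HoleDFX₅-∉m₃/l₃ fgraph     = F-∉m₃/l₃
HoleDFX₅-∉m₃/l₃ xgraph     = X₅-∉m₃/l₃

-- The three small forbidden graphs as fans

-- Each label sends a vertex xᵢ of the forbidden graph to its place in the fan.
D-nbrs : List ℕ
D-nbrs = 0 ∷ 2 ∷ 4 ∷ []

D-label : Fin 6 → ℕ
D-label = lookup (1 ∷ 0 ∷ 5 ∷ 4 ∷ 3 ∷ 2 ∷ [])

D-is-fan : IsEmbedding D (fan D-nbrs) D-label
D-is-fan = from-yes (isEmbedding? D (fan D-nbrs) _≟_ D-label)

X₅-nbrs : List ℕ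
X₅-nbrs = 0 ∷ 2 ∷ 3 ∷ 4 ∷ []

X₅-label : Fin 6 → ℕ
X₅-label = lookup (5 ∷ 4 ∷ 3 ∷ 2 ∷ 1 ∷ 0 ∷ [])

X₅-is-fan : IsEmbedding X₅ (fan X₅-nbrs) X₅-label
X₅-is-fan = from-yes (isEmbedding? X₅ (fan X₅-nbrs) _≟_ X₅-label)

F-nbrs : List ℕ
F-nbrs = 0 ∷ 2 ∷ 3 ∷ 5 ∷ []

F-label : Fin 7 → ℕ
F-label = lookup (5 ∷ 6 ∷ 0 ∷ 1 ∷ 2 ∷ 3 ∷ 4 ∷ [])

F-is-fan : IsEmbedding F (fan F-nbrs) F-label
F-is-fan = from-yes (isEmbedding? F (fan F-nbrs) _≟_ F-label)

-- Neighbours of a vertex on an induced path of a free graph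

module _ {n} {G : Graph (Fin n)} (free : (HoleDFX₅ -free) G) where

  -- The only place where `free` is applied: `y` together with `p` is an induced fan, and `σ`
  -- locates the forbidden graph in it.
  no-fan : ∀ {m} {H : Graph (Fin m)} {S σ N p y} → HoleDFX₅ H →
           IsEmbedding H (fan S) σ → (∀ i → σ i ≤ suc N) →
           EmbedsUpTo path G N p → (∀ {i} → i ≤ N → y ≢ p i) →
           ¬ (∀ {i} → i ≤ N → i ∈ˡ S ⇔ G ⊢ y ~ p i)
  no-fan bad e σ≤ ind y∉p nbrs =
    free bad (embedding⇒induced (embedding-∘ e σ≤ (fan-embeds ind y∉p nbrs)))

  no-gap : ∀ {K p y} → EmbedsUpTo path G K p → 3 ≤ K → (∀ {i} → i ≤ K → y ≢ p i) →
           G ⊢ y ~ p 0 → G ⊢ y ~ p K → ¬ (∀ {i} → 0 < i → i < K → ¬ G ⊢ y ~ p i)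
  no-gap {K} {p} {y} ind 3≤K y∉p y~p₀ y~pₖ y≁p =
    no-fan (hole (s≤s (s≤s 3≤K))) (cycle-is-fan K) (≤-pred ∘ toℕ<n) ind y∉p nbrs
    where
    nbrs : ∀ {i} → i ≤ K → i ∈ˡ (0 ∷ K ∷ []) ⇔ G ⊢ y ~ p i
    nbrs {i} i≤K = mk⇔ (λ { (here refl) → y~p₀ ; (there (here refl)) → y~pₖ }) (back i i≤K)
      where
      back : ∀ i → i ≤ K → G ⊢ y ~ p i → i ∈ˡ (0 ∷ K ∷ [])
      back zero    _ _ = here refl
      back (suc i) i<K a with suc i ≟ K
      ... | yes eq = there (here eq)
      ... | no neq = contradiction a (y≁p (s≤s z≤n) (≤∧≢⇒< i<K neq))

  -- Strong induction on `N`. A neighbour of `y` strictly inside cuts the path down to a shorter one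
  -- with the same `p 1` and `p 2`; with no such neighbour the whole path is a gap of length at
  -- least three and closes a hole.
  no-long-gap : ∀ {y} N {p} → EmbedsUpTo path G N p → (∀ {i} → i ≤ N → y ≢ p i) →
                0 < N → G ⊢ y ~ p 0 → G ⊢ y ~ p N → ¬ G ⊢ y ~ p 1 → ¬ ¬ G ⊢ y ~ p 2
  no-long-gap {y} = <-rec NoLongGap step
    where
    NoLongGap : ℕ → Set
    NoLongGap N = ∀ {p} → EmbedsUpTo path G N p → (∀ {i} → i ≤ N → y ≢ p i) →
                  0 < N → G ⊢ y ~ p 0 → G ⊢ y ~ p N → ¬ G ⊢ y ~ p 1 → ¬ ¬ G ⊢ y ~ p 2

    step : ∀ N → (∀ {M} → M < N → NoLongGap M) → NoLongGap N
    step 1 _ _ _ _ _ y~p₁ y≁p₁ _ = y≁p₁ y~p₁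
    step 2 _ _ _ _ _ y~p₂ _ y≁p₂ = y≁p₂ y~p₂
    step N@(suc (suc (suc _))) rec {p} ind y∉p 0<N y~p₀ y~pₙ y≁p₁ y≁p₂
      with anyUpTo? (λ i → (0 <? i) ×-dec _~?_ G y (p i)) N
    ... | yes (i , i<N , 0<i , y~pᵢ) =
      rec i<N (path-prefix (<⇒≤ i<N) ind) (λ j≤i → y∉p (≤-trans j≤i (<⇒≤ i<N)))
          0<i y~p₀ y~pᵢ y≁p₁ y≁p₂
    ... | no none = no-gap ind (s≤s (s≤s (s≤s z≤n))) y∉p y~p₀ y~pₙ
                      (λ {i} 0<i i<N a → none (i , i<N , 0<i , a))

  -- The bound certifies that `p 2` still lies on the path; the case of `F` relies on it.
  next-neighbour : ∀ {N p y} → EmbedsUpTo path G N p → (∀ {i} → i ≤ N → y ≢ p i) →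
                   0 < N → G ⊢ y ~ p 0 → G ⊢ y ~ p N → ¬ G ⊢ y ~ p 1 → 2 ≤ N × G ⊢ y ~ p 2
  next-neighbour {1} _ _ _ _ y~p₁ y≁p₁ = contradiction y~p₁ y≁p₁
  next-neighbour {suc (suc N)} {p} {y} ind y∉p 0<N y~p₀ y~pₙ y≁p₁ =
    s≤s (s≤s z≤n) , decidable-stable (_~?_ G y (p 2)) (no-long-gap _ ind y∉p 0<N y~p₀ y~pₙ y≁p₁)

  no-apex : ∀ {N p y} → EmbedsUpTo path G (4 + N) p →
            G ⊢ y ~ p 0 → G ⊢ y ~ p (4 + N) → ¬ ¬ G ⊢ y ~ p 1
  no-apex {N} {p} {y} ind y~p₀ y~pₙ y≁p₁ = by-third (_~?_ G y (p 3)) (_~?_ G y (p 4))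
    where
    y∉p : ∀ {i} → i ≤ 4 + N → y ≢ p i
    -- A path vertex adjacent to `p 0` has index 1, which is too far from the other end.
    y∉p i≤ eq with from (proj₂ (at ind i≤ z≤n)) (subst (G ⊢_~ p 0) eq y~p₀)
                 | from (proj₂ (at ind i≤ ≤-refl)) (subst (G ⊢_~ p (4 + N)) eq y~pₙ)
    ... | inj₂ refl | inj₁ ()
    ... | inj₂ refl | inj₂ ()

    tail₂ : EmbedsUpTo path G (2 + N) (λ i → p (2 + i))
    tail₂ = path-tail (path-tail ind)

    y~p₂ : G ⊢ y ~ p 2
    y~p₂ = proj₂ (next-neighbour ind y∉p (s≤s z≤n) y~p₀ y~pₙ y≁p₁)

    nbr : ∀ {S i} → i ∈ˡ S → G ⊢ y ~ p i → i ∈ˡ S ⇔ G ⊢ y ~ p i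
    nbr i∈S a = mk⇔ (λ _ → a) (λ _ → i∈S)

    non-nbr : ∀ {S i} → ¬ i ∈ˡ S → ¬ G ⊢ y ~ p i → i ∈ˡ S ⇔ G ⊢ y ~ p i
    non-nbr i∉S ¬a = mk⇔ (λ i∈S → contradiction i∈S i∉S) (λ a → contradiction a ¬a)

    -- Cutting the path after `p M` leaves finitely many adjacencies of `y`, which can be listed one
    -- by one.
    no-small-fan : ∀ M {m} {H : Graph (Fin m)} {S σ} → HoleDFX₅ H → IsEmbedding H (fan S) σ →
                   (∀ i → σ i ≤ suc M) → M ≤ 4 + N →
                   ¬ All (λ i → i ∈ˡ S ⇔ G ⊢ y ~ p i) (upTo (suc M))
    no-small-fan M bad e σ≤ M≤ nbrs =
      no-fan bad e σ≤ (path-prefix M≤ ind) (λ i≤M → y∉p (≤-trans i≤M M≤))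
             (λ i≤M → All.lookup nbrs (∈-upTo⁺ (s≤s i≤M)))

    4≤4+N : 4 ≤ 4 + N
    4≤4+N = s≤s (s≤s (s≤s (s≤s z≤n)))

    by-third : Dec (G ⊢ y ~ p 3) → Dec (G ⊢ y ~ p 4) → ⊥
    by-third (no y≁p₃) _ = no-small-fan 4 domino D-is-fan (from-yes (all? λ i → D-label i ≤? 5)) 4≤4+N
      ( nbr (here refl) y~p₀ ∷ non-nbr (from-no (1 ∈ᴺ? D-nbrs)) y≁p₁ ∷ nbr (there (here refl)) y~p₂
      ∷ non-nbr (from-no (3 ∈ᴺ? D-nbrs)) y≁p₃ ∷ nbr (there (there (here refl))) y~p₄ ∷ [])
      where
      y~p₄ : G ⊢ y ~ p 4
      -- The path is restarted at `p 2`, where `y` again misses the following vertex.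
      y~p₄ = proj₂ (next-neighbour tail₂ (λ i≤ → y∉p (s≤s (s≤s i≤))) (s≤s z≤n) y~p₂ y~pₙ y≁p₃)
    by-third (yes y~p₃) (yes y~p₄) =
      no-small-fan 4 xgraph X₅-is-fan (from-yes (all? λ i → X₅-label i ≤? 5)) 4≤4+N
      ( nbr (here refl) y~p₀ ∷ non-nbr (from-no (1 ∈ᴺ? X₅-nbrs)) y≁p₁ ∷ nbr (there (here refl)) y~p₂
      ∷ nbr (there (there (here refl))) y~p₃ ∷ nbr (there (there (there (here refl)))) y~p₄ ∷ [])
    by-third (yes y~p₃) (no y≁p₄)
      -- Restarting at `p 3` gives both `y ~ p 5` and the fact that the path reaches `p 5`.
      with next-neighbour (path-tail tail₂) (λ i≤ → y∉p (s≤s (s≤s (s≤s i≤)))) (s≤s z≤n) y~p₃ y~pₙ y≁p₄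
    ... | 2≤1+N , y~p₅ =
      no-small-fan 5 fgraph F-is-fan (from-yes (all? λ i → F-label i ≤? 6)) (s≤s (s≤s (s≤s 2≤1+N)))
      ( nbr (here refl) y~p₀ ∷ non-nbr (from-no (1 ∈ᴺ? F-nbrs)) y≁p₁ ∷ nbr (there (here refl)) y~p₂
      ∷ nbr (there (there (here refl))) y~p₃ ∷ non-nbr (from-no (4 ∈ᴺ? F-nbrs)) y≁p₄
      ∷ nbr (there (there (there (here refl)))) y~p₅ ∷ [])

  -- Prepending `x` to `p` gives an induced path with at least four edges; `y` sees both of its ends
  -- but not its second vertex `p 0`.
  no-undominated-edge :
    ∀ {N p x y} → 3 ≤ N → EmbedsUpTo path G N p → (∀ {i} → i ≤ N → x ≢ p i) →
    (∀ {i} → 0 < i → i < N → ¬ G ⊢ x ~ p i) → G ⊢ x ~ p 0 → ¬ G ⊢ x ~ p N →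
    G ⊢ y ~ x → G ⊢ y ~ p N → ¬ ¬ G ⊢ y ~ p 0
  -- Matching on the bound brings `suc N` to the shape `4 + _` that `no-apex` expects.
  no-undominated-edge {N} {p} {x} 3≤N@(s≤s (s≤s (s≤s _))) ind x∉p x≁p x~p₀ x≁pₙ y~x y~pₙ y≁p₀ =
    no-apex (path-extend ind x∉p x~p₀ x≁) y~x y~pₙ y≁p₀
    where
    x≁ : ∀ {i} → 0 < i → i ≤ N → ¬ G ⊢ x ~ p i
    x≁ {i} 0<i i≤N with i ≟ N
    ... | yes refl = x≁pₙ
    ... | no i≢N   = x≁p 0<i (≤∧≢⇒< i≤N i≢N)

  -- Free graphs satisfy domination

  m₃-dominates-l₃ : (m₃ / l₃) G
  m₃-dominates-l₃ u v _ W W′ ((W-inj , W-adj) , 3≤N) ((_ , W′-adj) , l≤3) j j-int =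
    -- Domination of a vertex is decidable, so an undominated one may be assumed.
    decidable-stable (isDominated? G Fin._≟_ (vertex W) (vertex W′ j))
                     (λ undom → absurd W′ W′-adj l≤3 j j-int undom)
    where
    open Walk using (length; vertex; start; end; Internal)

    N : ℕ
    N = length W

    index : ℕ → Fin (suc N)
    -- Indices are clamped at `N`, so `p` repeats the last vertex of `W` beyond it.
    index i = fromℕ< (s≤s (m⊓n≤n i N))

    toℕ-index : ∀ {i} → i ≤ N → toℕ (index i) ≡ i
    toℕ-index {i} i≤N = trans (toℕ-fromℕ< (s≤s (m⊓n≤n i N))) (m≤n⇒m⊓n≡m i≤N)

    p : ℕ → Fin n
    p i = vertex W (index i)

    p₀≡u : p 0 ≡ u
    p₀≡u = start W

    pₙ≡v : p N ≡ v
    pₙ≡v = trans (cong (vertex W) (toℕ-injective (trans (toℕ-index ≤-refl) (sym (toℕ-fromℕ N)))))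
                 (end W)

    ind : EmbedsUpTo path G N p
    ind = embedsUpTo λ {i} {j} i≤N j≤N →
        (λ eq → trans (sym (toℕ-index i≤N)) (trans (cong toℕ (W-inj eq)) (toℕ-index j≤N)))
      , subst₂ (λ a b → path ⊢ a ~ b ⇔ G ⊢ p i ~ p j) (toℕ-index i≤N) (toℕ-index j≤N)
               (⇔-sym (W-adj (index i) (index j)))

    module _ {x} (undom : ¬ IsDominated G (vertex W) x) where

      x∉p : ∀ i → x ≢ p i
      x∉p i eq = undom (inj₂ (index i , eq))

      x≁p : ∀ {i} → 0 < i → i < N → ¬ G ⊢ x ~ p i
      x≁p {i} 0<i i<N a = undom (inj₁ (index i , (subst (0 <_) eq 0<i , subst (_< N) eq i<N) , a))
        where
        eq : i ≡ toℕ (index i)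
        eq = sym (toℕ-index (<⇒≤ i<N))

    absurd : (W′ : Walk G u v) →
             (∀ i j → (G ⊢ vertex W′ i ~ vertex W′ j) ⇔ Consecutive i j) → length W′ ≤ 3 →
             ∀ j → Internal W′ j → ¬ ¬ IsDominated G (vertex W) (vertex W′ j)
    -- The middle vertex sees both ends of `W` and nothing between them, so all of `W` is a gap.
    absurd record { length = 2 ; vertex = q ; start = refl ; end = refl } adj _ (suc zero) _ undom =
      no-gap ind 3≤N (λ {i} _ → x∉p undom i)
        (subst (G ⊢ q (# 1) ~_) (sym p₀≡u) (from (adj (# 1) (# 0)) (inj₂ refl)))
        (subst (G ⊢ q (# 1) ~_) (sym pₙ≡v) (from (adj (# 1) (# 2)) (inj₁ refl)))
        (x≁p undom)
    absurd record { length = 3 ; vertex = q ; start = refl ; end = refl } adj _ (suc zero) _ undom =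
      no-undominated-edge 3≤N ind (λ {i} _ → x∉p undom i) (x≁p undom)
        (subst (G ⊢ q (# 1) ~_) (sym p₀≡u) (from (adj (# 1) (# 0)) (inj₂ refl)))
        (from-no (_~?_ path 1 3) ∘ to (adj (# 1) (# 3)) ∘ subst (G ⊢ q (# 1) ~_) pₙ≡v)
        (from (adj (# 2) (# 1)) (inj₂ refl))
        (subst (G ⊢ q (# 2) ~_) (sym pₙ≡v) (from (adj (# 2) (# 3)) (inj₁ refl)))
        (from-no (_~?_ path 2 0) ∘ to (adj (# 2) (# 0)) ∘ subst (G ⊢ q (# 2) ~_) p₀≡u)
    -- The undominated vertex is now next to `v`, so `W` is traversed backwards.
    absurd record { length = 3 ; vertex = q ; start = refl ; end = refl } adj _ (suc (suc zero)) _ undom =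
      no-undominated-edge 3≤N (path-reverse ind) (λ {i} _ → x∉p undom (N ∸ i))
        (λ 0<i i<N → x≁p undom (m<n⇒0<n∸m i<N) (∸-monoʳ-< 0<i (<⇒≤ i<N)))
        (subst (G ⊢ q (# 2) ~_) (sym pₙ≡v) (from (adj (# 2) (# 3)) (inj₁ refl)))
        (from-no (_~?_ path 2 0) ∘ to (adj (# 2) (# 0)) ∘ subst (G ⊢ q (# 2) ~_) rev-end)
        (from (adj (# 1) (# 2)) (inj₁ refl))
        (subst (G ⊢ q (# 1) ~_) (sym rev-end) (from (adj (# 1) (# 0)) (inj₂ refl)))
        (from-no (_~?_ path 1 3) ∘ to (adj (# 1) (# 3)) ∘ subst (G ⊢ q (# 1) ~_) pₙ≡v)
      where
      rev-end : p (N ∸ N) ≡ q (# 0)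
      -- `N ∸ 0` reduces to `N` by computation, but `N ∸ N` needs a rewrite.
      rev-end = trans (cong p (n∸n≡0 N)) p₀≡u
    absurd record { length = 0 } _ _ zero (() , _)
    absurd record { length = 1 } _ _ (suc zero) (_ , s≤s ())
    absurd record { length = 2 } _ _ (suc (suc zero)) (_ , s≤s (s≤s ()))
    absurd record { length = 3 } _ _ (suc (suc (suc zero))) (_ , s≤s (s≤s (s≤s ())))
    absurd record { length = suc (suc (suc (suc _))) } _ (s≤s (s≤s (s≤s ())))

theorem10 : ∀ (n : ℕ) (G : Graph (Fin n)) → Connected G →
    (m₃ / l₃) G ⇔ (HoleDFX₅ -free) G
theorem10 n G _ = mk⇔ necessary (λ free → m₃-dominates-l₃ free)
  where
  necessary : (m₃ / l₃) G → (HoleDFX₅ -free) G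
  necessary dom bad (_ , iso) =
    HoleDFX₅-∉m₃/l₃ bad (m₃/l₃-hereditary (proj₂ (induced⇒embedding iso)) dom)
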